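{- Let $\mathbf{X},\mathbf{Y}$ be quasivarieties and let $\langle\zeta,f\rangle:Tm(\mathcal{L}_{\mathbf{X}})\to Tm(\mathcal{L}_{\mathbf{Y}})$ be a sober translation. Then the assignment $\tau:\Xi(\mathbf{X})\to\Xi^f(\mathbf{Y})$, $\tau(\mathbf{K})=\{\mathcal{A}\in\mathbf{Y}:\theta(\mathcal{A})\in\mathbf{K}\}$, is a lattice isomorphism.
   Context: A quasivariety is a class of similar algebras closed under isomorphisms, subalgebras and reduced products. $\mathbf{X},\mathbf{Y}$ have languages $\mathcal{L}_{\mathbf{X}},\mathcal{L}_{\mathbf{Y}}$; $\Xi(\mathbf{K})$ is the lattice of subquasivarieties of $\mathbf{K}$. For a class $\mathbf{K}$, $\Phi\vDash_{\mathbf{K}}\lambda\approx\gamma$ means every assignment into an algebra of $\mathbf{K}$ satisfying $\Phi$ satisfies $\lambda\approx\gamma$. Selective translation: $\zeta$ assigns to each $n$-ary symbol $g\in\mathcal{L}_{\mathbf{X}}$ an $n$-ary term $\zeta(g)$ of $\mathcal{L}_{\mathbf{Y}}$; $f(x)$ is a unary term of $\mathcal{L}_{\mathbf{Y}}$ (the selector). For an infinite variable set $V$ define $\zeta_*:Tm(\mathcal{L}_{\mathbf{X}},V)\to Tm(\mathcal{L}_{\mathbf{Y}},V)$ by $\zeta_*(x)=f(x)$ on variables and $\zeta_*(g(\phi_1,\dots,\phi_n))=\zeta(g)(\zeta_*(\phi_1),\dots,\zeta_*(\phi_n))$ (in particular $\zeta_*(c)=\zeta(c)$ for constants), and $\zeta^*(\Phi)=\{\zeta_*(\delta)\approx\zeta_*(\gamma):\delta\approx\gamma\in\Phi\}$.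 $\langle\zeta,f\rangle$ is a selective translation if: (i) $\vDash_{\mathbf{Y}}f(f(x))\approx f(x)$; (ii) $\Phi\vDash_{\mathbf{X}}\lambda\approx\gamma$ implies $\zeta^*(\Phi)\cup\{f(x)\approx x:x\in V\}\vDash_{\mathbf{Y}}\zeta^*(\lambda\approx\gamma)$; (iii) for each $n$-ary $g\in\mathcal{L}_{\mathbf{X}}$, $\{f(x_i)\approx x_i:i\le n\}\vDash_{\mathbf{Y}}f(\zeta(g)(x_1,\dots,x_n))\approx\zeta(g)(x_1,\dots,x_n)$. For $\mathcal{A}\in\mathbf{Y}$, $\mathcal{A}^f=\{a\in A:f(a)=a\}$, and $\theta(\mathcal{A})\in\mathbf{X}$ is the algebra with universe $\mathcal{A}^f$ and operations $g^{\theta(\mathcal{A})}=\zeta(g)^{\mathcal{A}}$ restricted to $\mathcal{A}^f$. With restriction on homomorphisms, $\theta:\mathbf{Y}\to\mathbf{X}$ is a right adjoint functor; $\mathcal{F}:\mathbf{X}\to\mathbf{Y}$ is its left adjoint, with unit $\eta:1\Rightarrow\theta\mathcal{F}$ and counit $\varepsilon:\mathcal{F}\theta\Rightarrow1$. A selective translation is strongly selective if $\eta$ is an isomorphism, and sober if moreover $\varepsilon$ is pointwise injective and $\mathcal{F}$ preserves injective homomorphisms. For $\mathcal{A},\mathcal{B}\in\mathbf{Y}$, $\mathcal{B}\preceq_f\mathcal{A}$ means $\mathcal{B}$ is a subalgebra of $\mathcal{A}$ with $\mathcal{B}^f=\mathcal{A}^f$; for $\mathbf{K}\in\Xi(\mathbf{Y})$,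 $\mathbf{K}^\uparrow=\{\mathcal{A}\in\mathbf{Y}:\exists\mathcal{B}\in\mathbf{K},\ \mathcal{B}\preceq_f\mathcal{A}\}$; $\Xi^f(\mathbf{Y})=\{\mathbf{K}^\uparrow:\mathbf{K}\in\Xi(\mathbf{Y})\}$ is the complete lattice (under inclusion) of $\mathsf{PAt}$-$f$-quasivarieties. -}

module Defs where

open import Algebra.Lattice.Bundles using (RawLattice)
import Algebra.Lattice.Bundles as Alg
open import Axiom.ExcludedMiddle using (ExcludedMiddle)
open import Data.Empty using (⊥-elim)
open import Data.Fin.Base using (Fin; zero; suc; toℕ)
open import Data.Fin.Properties using (toℕ-injective)
open import Data.List.Base using (List; []; _∷_; _++_; length; lookup; concatMap; tabulate)
open import Data.List.Membership.Propositional using () renaming (_∈_ to _∈ˡ_)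
open import Data.List.Membership.Propositional.Properties
  using (∈-++⁺ˡ; ∈-++⁺ʳ; ∈-concatMap⁺; ∈-tabulate⁺)
open import Data.List.Relation.Unary.Any using (here; there; index)
import Data.List.Relation.Unary.Any as Any
open import Data.List.Relation.Unary.Any.Properties using (lookup-index)
open import Data.Nat.Base using (ℕ; zero; suc)
open import Data.Product.Base using (Σ-syntax; ∃; ∃-syntax; _×_; _,_; proj₁; proj₂)
open import Data.Sum.Base using (inj₁; inj₂; [_,_]′)
open import Data.Unit.Polymorphic.Base using (⊤)
open import Function.Base using (id; _∘_)
open import Function.Bundles using (Func; _↣_; Injection)
open import Function.Definitions using (Injective)
open import Level using (Level; _⊔_; lift; lower) renaming (suc to lsuc)
open import Relation.Binary.Bundles using (Setoid)
open import Relation.Binary.Definitions using (_Respects_)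
import Relation.Binary.Construct.On as On
open import Relation.Binary.Lattice.Bundles using (Lattice)
import Relation.Binary.Lattice.Properties.Lattice as LatticeProperties
open import Relation.Binary.PropositionalEquality.Core as ≡ using (_≡_)
open import Relation.Nullary using (¬_; yes; no)
open import Relation.Nullary.Decidable using (map′)
open import Relation.Unary using (Pred; _∈_; _⊆_; _≐_; _∩_; _∪_; ∅)
open import Relation.Unary.Relation.Binary.Subset using (⊆-isPartialOrder)

private
  variable
    ℓ v w p : Level

record Signature ℓ : Set (lsuc ℓ) where
  field
    Op    : Set ℓ
    arity : Op → ℕ

open Signature public

-- Equality is that of a setoid, so that quotients (hence reduced
-- products) exist.  Universes are nonempty, as usual in universal
-- algebra; the witness `point` is not an operation, and homomorphisms
-- need not preserve it.
record Algebra (L : Signature ℓ) : Set (lsuc ℓ) where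
  field
    setoid  : Setoid ℓ ℓ
  open Setoid setoid public
  field
    point   : Carrier
    op      : (g : Op L) → (Fin (arity L g) → Carrier) → Carrier
    op-cong : ∀ g {xs ys} → (∀ i → xs i ≈ ys i) → op g xs ≈ op g ys

∣_∣ : {L : Signature ℓ} → Algebra L → Set ℓ
∣ A ∣ = Algebra.Carrier A

record Hom {L : Signature ℓ} (A B : Algebra L) : Set ℓ where
  private
    module A = Algebra A
    module B = Algebra B
  field
    func : Func A.setoid B.setoid
  open Func func public using (to; cong)
  field
    homo : ∀ g xs → to (A.op g xs) B.≈ B.op g (to ∘ xs)

open Hom public using (to)

module _ {L : Signature ℓ} where

  infix 4 _≗_

  _≗_ : {A B : Algebra L} → Hom A B → Hom A B → Set ℓ
  _≗_ {B = B} h k = ∀ x → Algebra._≈_ B (to h x) (to k x)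

  idHom : {A : Algebra L} → Hom A A
  idHom {A} = record
    { func = record { to = id ; cong = id }
    ; homo = λ _ _ → Algebra.refl A
    }

  infixr 9 _⊙_

  _⊙_ : {A B C : Algebra L} → Hom B C → Hom A B → Hom A C
  _⊙_ {C = C} k h = record
    { func = record { to = to k ∘ to h ; cong = Hom.cong k ∘ Hom.cong h }
    ; homo = λ g xs → Algebra.trans C (Hom.cong k (Hom.homo h g xs)) (Hom.homo k g (to h ∘ xs))
    }

  IsInjective : {A B : Algebra L} → Hom A B → Set ℓ
  IsInjective {A} {B} h = Injective (Algebra._≈_ A) (Algebra._≈_ B) (to h)

  IsIso : {A B : Algebra L} → Hom A B → Set ℓ
  IsIso {A} {B} h = Σ[ k ∈ Hom B A ] (h ⊙ k ≗ idHom × k ⊙ h ≗ idHom)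

  infix 4 _≅_

  _≅_ : Algebra L → Algebra L → Set ℓ
  A ≅ B = Σ[ h ∈ Hom A B ] IsIso h

record Subalgebra {L : Signature ℓ} (A : Algebra L) : Set (lsuc ℓ) where
  open Algebra A
  field
    universe : Pred Carrier ℓ
    respects : universe Respects _≈_
    nonempty : ∃ universe
    closed   : ∀ g xs → (∀ i → xs i ∈ universe) → op g xs ∈ universe

open Subalgebra public

module _ {L : Signature ℓ} {A : Algebra L} where
  open Algebra A

  ⌊_⌋ : Subalgebra A → Algebra L
  ⌊ B ⌋ = record
    { setoid  = On.setoid setoid (proj₁ {B = universe B})
    ; point   = nonempty B
    ; op      = λ g xs → op g (proj₁ ∘ xs) , closed B g _ (proj₂ ∘ xs)
    ; op-cong = λ g → op-cong g
    }

  inclusion : (B : Subalgebra A) → Hom ⌊ B ⌋ A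
  inclusion B = record
    { func = record { to = proj₁ ; cong = id }
    ; homo = λ _ _ → refl
    }

-- The improper filter is allowed.
record Filter (I : Set ℓ) : Set (lsuc ℓ) where
  field
    Large    : Pred (Pred I ℓ) ℓ
    whole    : Large (λ _ → ⊤)
    upward   : ∀ {P Q} → P ⊆ Q → Large P → Large Q
    binary-∩ : ∀ {P Q} → Large P → Large Q → Large (P ∩ Q)

  pure : ∀ {P} → (∀ i → P i) → Large P
  pure f = upward (λ {i} _ → f i) whole

  finite-⋂ : ∀ n {P : Fin n → Pred I ℓ} →
             (∀ k → Large (P k)) → Large (λ i → ∀ k → P k i)
  finite-⋂ zero    _  = pure (λ _ ())
  finite-⋂ (suc n) Ps = upward (λ { (p , ps) zero → p ; (p , ps) (suc k) → ps k })
    (binary-∩ (Ps zero) (finite-⋂ n (Ps ∘ suc)))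

open Filter public using (Large)

⨅ : {L : Signature ℓ} {I : Set ℓ} → (I → Algebra L) → Filter I → Algebra L
⨅ {L = L} {I} A 𝓕 = record
  { setoid = record
    { Carrier       = ∀ i → ∣ A i ∣
    ; _≈_           = λ a b → Large 𝓕 (λ i → Algebra._≈_ (A i) (a i) (b i))
    ; isEquivalence = record
      { refl  = F.pure (λ i → Algebra.refl (A i))
      ; sym   = F.upward (λ {i} → Algebra.sym (A i))
      ; trans = λ p q → F.upward (λ {i} (x , y) → Algebra.trans (A i) x y) (F.binary-∩ p q)
      }
    }
  ; point   = λ i → Algebra.point (A i)
  ; op      = λ g xs i → Algebra.op (A i) g (λ k → xs k i)
  ; op-cong = λ g ps → F.upward (λ {i} → Algebra.op-cong (A i) g) (F.finite-⋂ (arity L g) ps)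
  }
  where module F = Filter 𝓕

Class : Signature ℓ → Set (lsuc (lsuc ℓ))
Class {ℓ} L = Pred (Algebra L) (lsuc ℓ)

-- Closure is under reduced products of arbitrary (possibly empty)
-- families indexed by sets of the same universe ℓ as the algebras.
record IsQuasivariety {L : Signature ℓ} (K : Class L) : Set (lsuc ℓ) where
  field
    iso-closed : ∀ {A B} → A ≅ B → A ∈ K → B ∈ K
    sub-closed : ∀ {A} (B : Subalgebra A) → A ∈ K → ⌊ B ⌋ ∈ K
    red-closed : ∀ {I : Set ℓ} (A : I → Algebra L) (𝓕 : Filter I) →
                 (∀ i → A i ∈ K) → ⨅ A 𝓕 ∈ K

record Quasivariety (L : Signature ℓ) : Set (lsuc (lsuc ℓ)) where
  field
    class          : Class L
    isQuasivariety : IsQuasivariety class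
  open IsQuasivariety isQuasivariety public

open Quasivariety public using (class)

data Term (L : Signature ℓ) (V : Set v) : Set (ℓ ⊔ v) where
  var : V → Term L V
  app : (g : Op L) → (Fin (arity L g) → Term L V) → Term L V

module _ {L : Signature ℓ} where

  infix 30 _[_]

  _[_] : {V : Set v} {W : Set w} → Term L V → (V → Term L W) → Term L W
  var x    [ σ ] = σ x
  app g ts [ σ ] = app g (λ i → ts i [ σ ])

  infix 30 _⟨_⟩

  _⟨_⟩ : {W : Set w} → Term L (Fin 1) → Term L W → Term L W
  f ⟨ t ⟩ = f [ (λ _ → t) ]

  infix 30 _⟦_⟧_

  _⟦_⟧_ : (A : Algebra L) {V : Set v} → Term L V → (V → ∣ A ∣) → ∣ A ∣
  A ⟦ var x    ⟧ ρ = ρ x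
  A ⟦ app g ts ⟧ ρ = Algebra.op A g (λ i → A ⟦ ts i ⟧ ρ)

infix 5 _≋_

record Equation (L : Signature ℓ) (V : Set v) : Set (ℓ ⊔ v) where
  constructor _≋_
  field
    lhs rhs : Term L V

module _ {L : Signature ℓ} where

  Holds : (A : Algebra L) {V : Set v} → (V → ∣ A ∣) → Equation L V → Set ℓ
  Holds A ρ (s ≋ t) = Algebra._≈_ A (A ⟦ s ⟧ ρ) (A ⟦ t ⟧ ρ)

  infix 4 _⊨[_]_

  _⊨[_]_ : {V : Set v} → Pred (Equation L V) p → Class L → Equation L V → Set (lsuc ℓ ⊔ v ⊔ p)
  Φ ⊨[ K ] e = ∀ A → A ∈ K → ∀ ρ → (∀ {e′} → e′ ∈ Φ → Holds A ρ e′) → Holds A ρ e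

FixedVars : {L : Signature ℓ} → Term L (Fin 1) → {V : Set v} → Pred (Equation L V) (ℓ ⊔ v)
FixedVars f e = ∃[ x ] e ≡ (f ⟨ var x ⟩ ≋ var x)

module _ {L M : Signature ℓ} (ζ : (g : Op L) → Term M (Fin (arity L g))) (f : Term M (Fin 1))
         {V : Set v} where

  ζ⁎ : Term L V → Term M V
  ζ⁎ (var x)    = f ⟨ var x ⟩
  ζ⁎ (app g ts) = ζ g [ (λ i → ζ⁎ (ts i)) ]

  ζ⁎-eqn : Equation L V → Equation M V
  ζ⁎-eqn (s ≋ t) = ζ⁎ s ≋ ζ⁎ t

  ζ* : Pred (Equation L V) p → Pred (Equation M V) (ℓ ⊔ v ⊔ p)
  ζ* Φ e = ∃[ d ] d ∈ Φ × e ≡ ζ⁎-eqn d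

record SelectiveTranslation {L M : Signature ℓ} (X : Quasivariety L) (Y : Quasivariety M)
                            (V : Set ℓ) : Set (lsuc ℓ) where
  field
    ζ          : (g : Op L) → Term M (Fin (arity L g))
    f          : Term M (Fin 1)
    idempotent : ∅ ⊨[ class Y ] (f ⟨ f ⟩ ≋ f)
    preserves  : (Φ : Pred (Equation L V) ℓ) (e : Equation L V) → Φ ⊨[ class X ] e →
                 (ζ* ζ f Φ ∪ FixedVars f) ⊨[ class Y ] ζ⁎-eqn ζ f e
    ζ-closed   : ∀ g → FixedVars f ⊨[ class Y ] (f ⟨ ζ g ⟩ ≋ ζ g)

module _ {L : Signature ℓ} where

  eval-cong : (A : Algebra L) {V : Set v} (t : Term L V) {ρ σ : V → ∣ A ∣} →
              (∀ x → Algebra._≈_ A (ρ x) (σ x)) → Algebra._≈_ A (A ⟦ t ⟧ ρ) (A ⟦ t ⟧ σ)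
  eval-cong A (var x)    ρ≈σ = ρ≈σ x
  eval-cong A (app g ts) ρ≈σ = Algebra.op-cong A g (λ i → eval-cong A (ts i) ρ≈σ)

  eval-subst : (A : Algebra L) {V : Set v} {W : Set w} (t : Term L V) {σ : V → Term L W}
               {ρ : W → ∣ A ∣} →
               Algebra._≈_ A (A ⟦ t [ σ ] ⟧ ρ) (A ⟦ t ⟧ (λ x → A ⟦ σ x ⟧ ρ))
  eval-subst A (var x)    = Algebra.refl A
  eval-subst A (app g ts) = Algebra.op-cong A g (λ i → eval-subst A (ts i))

  eval-hom : {A B : Algebra L} (h : Hom A B) {V : Set v} (t : Term L V) {ρ : V → ∣ A ∣} →
             Algebra._≈_ B (to h (A ⟦ t ⟧ ρ)) (B ⟦ t ⟧ (to h ∘ ρ))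
  eval-hom {B = B} h (var x)    = Algebra.refl B
  eval-hom {B = B} h (app g ts) =
    Algebra.trans B (Hom.homo h g _) (Algebra.op-cong B g (λ i → eval-hom h (ts i)))

  eval-⨅ : {I : Set ℓ} (A : I → Algebra L) (𝓕 : Filter I) {V : Set v} (t : Term L V)
           {ρ : V → ∀ i → ∣ A i ∣} (i : I) →
           Algebra._≈_ (A i) ((⨅ A 𝓕 ⟦ t ⟧ ρ) i) (A i ⟦ t ⟧ (λ x → ρ x i))
  eval-⨅ A 𝓕 (var x)    i = Algebra.refl (A i)
  eval-⨅ A 𝓕 (app g ts) i = Algebra.op-cong (A i) g (λ k → eval-⨅ A 𝓕 (ts k) i)

infix 30 _^_

_^_ : {L : Signature ℓ} (A : Algebra L) → Term L (Fin 1) → Pred ∣ A ∣ ℓ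
A ^ f = λ a → Algebra._≈_ A (A ⟦ f ⟧ (λ _ → a)) a

module _ {L : Signature ℓ} {f : Term L (Fin 1)} where

  ^-resp : (A : Algebra L) → (A ^ f) Respects Algebra._≈_ A
  ^-resp A a≈b fa≈a =
    Algebra.trans A (eval-cong A f (λ _ → Algebra.sym A a≈b)) (Algebra.trans A fa≈a a≈b)

  ^-hom : {A B : Algebra L} (h : Hom A B) {a : ∣ A ∣} → a ∈ A ^ f → to h a ∈ B ^ f
  ^-hom {B = B} h fa≈a = Algebra.trans B (Algebra.sym B (eval-hom h f)) (Hom.cong h fa≈a)

  ^-value : {K : Class L} → ∅ ⊨[ K ] (f ⟨ f ⟩ ≋ f) → {A : Algebra L} → A ∈ K →
            ∀ a → A ⟦ f ⟧ (λ _ → a) ∈ A ^ f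
  ^-value idem {A} A∈K a =
    Algebra.trans A (Algebra.sym A (eval-subst A f)) (idem A A∈K (λ _ → a) λ ())

-- A class of algebras is regarded as a full subcategory; its objects
-- carry their proof of membership.
Obj : {L : Signature ℓ} → Class L → Set (lsuc ℓ)
Obj K = ∃ K

record Functor {L M : Signature ℓ} (X : Class L) (Y : Class M) : Set (lsuc ℓ) where
  field
    F₀           : Obj X → Obj Y
    F₁           : {A B : Obj X} → Hom (proj₁ A) (proj₁ B) → Hom (proj₁ (F₀ A)) (proj₁ (F₀ B))
    F-resp-≗     : {A B : Obj X} {h k : Hom (proj₁ A) (proj₁ B)} →
                   h ≗ k → F₁ {A} {B} h ≗ F₁ {A} {B} k
    identity     : {A : Obj X} → F₁ {A} {A} idHom ≗ idHom
    homomorphism : {A B C : Obj X} {h : Hom (proj₁ A) (proj₁ B)} {k : Hom (proj₁ B) (proj₁ C)} →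
                   F₁ {A} {C} (k ⊙ h) ≗ F₁ {B} {C} k ⊙ F₁ {A} {B} h

infix 4 _⊣_

record _⊣_ {L M : Signature ℓ} {X : Class L} {Y : Class M}
           (F : Functor X Y) (G : Functor Y X) : Set (lsuc ℓ) where
  private
    module F = Functor F
    module G = Functor G
  field
    η         : (A : Obj X) → Hom (proj₁ A) (proj₁ (G.F₀ (F.F₀ A)))
    ε         : (B : Obj Y) → Hom (proj₁ (F.F₀ (G.F₀ B))) (proj₁ B)
    η-natural : {A B : Obj X} (h : Hom (proj₁ A) (proj₁ B)) →
                η B ⊙ h ≗ G.F₁ {F.F₀ A} {F.F₀ B} (F.F₁ {A} {B} h) ⊙ η A
    ε-natural : {A B : Obj Y} (h : Hom (proj₁ A) (proj₁ B)) →
                ε B ⊙ F.F₁ {G.F₀ A} {G.F₀ B} (G.F₁ {A} {B} h) ≗ h ⊙ ε A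
    zig       : (A : Obj X) → ε (F.F₀ A) ⊙ F.F₁ {A} {G.F₀ (F.F₀ A)} (η A) ≗ idHom
    zag       : (B : Obj Y) → G.F₁ {F.F₀ (G.F₀ B)} {B} (ε B) ⊙ η (G.F₀ B) ≗ idHom

module _ {L M : Signature ℓ} {X : Quasivariety L} {Y : Quasivariety M} {V : Set ℓ}
         (T : SelectiveTranslation X Y V) where
  open SelectiveTranslation T

  θ-alg : Obj (class Y) → Algebra L
  θ-alg (A , A∈Y) = record
    { setoid  = On.setoid A.setoid (proj₁ {B = _∈ A ^ f})
    ; point   = _ , ^-value {f = f} idempotent A∈Y A.point
    ; op      = λ g xs → A ⟦ ζ g ⟧ (proj₁ ∘ xs) ,
        A.trans (A.sym (eval-subst A f))
          (ζ-closed g A A∈Y (proj₁ ∘ xs)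
            λ { (i , ≡.refl) → A.trans (eval-subst A f) (proj₂ (xs i)) })
    ; op-cong = λ g → eval-cong A (ζ g)
    }
    where module A = Algebra A

  θ-hom : (A B : Obj (class Y)) → Hom (proj₁ A) (proj₁ B) → Hom (θ-alg A) (θ-alg B)
  θ-hom A B h = record
    { func = record
      { to   = λ (a , a∈Aᶠ) → to h a , ^-hom {f = f} h a∈Aᶠ
      ; cong = Hom.cong h
      }
    ; homo = λ g xs → eval-hom h (ζ g)
    }

  θ : (∀ A → θ-alg A ∈ class X) → Functor (class Y) (class X)
  θ θ∈X = record
    { F₀           = λ A → θ-alg A , θ∈X A
    ; F₁           = λ {A} {B} → θ-hom A B
    ; F-resp-≗     = λ h≗k x → h≗k (proj₁ x)
    ; identity     = λ {A} _ → Algebra.refl (proj₁ A)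
    ; homomorphism = λ {_} {_} {C} _ → Algebra.refl (proj₁ C)
    }

module _ {L M : Signature ℓ} {X : Class L} {Y : Class M}
         {F : Functor X Y} {G : Functor Y X} (F⊣G : F ⊣ G) where
  open _⊣_ F⊣G

  IsStronglySelective : Set (lsuc ℓ)
  IsStronglySelective = ∀ A → IsIso (η A)

  record IsSober : Set (lsuc ℓ) where
    field
      isStronglySelective : IsStronglySelective
      ε-injective         : ∀ B → IsInjective (ε B)
      F-injective         : (A B : Obj X) (h : Hom (proj₁ A) (proj₁ B)) →
                            IsInjective h → IsInjective (Functor.F₁ F {A} {B} h)

record Ξ {L : Signature ℓ} (K : Quasivariety L) : Set (lsuc (lsuc ℓ)) where
  field
    sub    : Quasivariety L
    sub⊆   : class sub ⊆ class K
  open Quasivariety sub public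

data Generated {L : Signature ℓ} (K : Class L) : Class L where
  gen-base : ∀ {A} → A ∈ K → Generated K A
  gen-iso  : ∀ {A B} → A ≅ B → Generated K A → Generated K B
  gen-sub  : ∀ {A} (B : Subalgebra A) → Generated K A → Generated K ⌊ B ⌋
  gen-red  : ∀ {I : Set ℓ} (A : I → Algebra L) (𝓕 : Filter I) →
             (∀ i → Generated K (A i)) → Generated K (⨅ A 𝓕)

module _ {L : Signature ℓ} where

  generated-isQuasivariety : (K : Class L) → IsQuasivariety (Generated K)
  generated-isQuasivariety K = record { iso-closed = gen-iso ; sub-closed = gen-sub ; red-closed = gen-red }

  generated-least : {K N : Class L} → IsQuasivariety N → K ⊆ N → Generated K ⊆ N
  generated-least {K} {N} N-qv K⊆N = go
    where
    open IsQuasivariety N-qv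
    go : ∀ {A} → Generated K A → A ∈ N
    go (gen-base A∈K)   = K⊆N A∈K
    go (gen-iso A≅B p)  = iso-closed A≅B (go p)
    go (gen-sub B p)    = sub-closed B (go p)
    go (gen-red A 𝓕 ps) = red-closed A 𝓕 (λ i → go (ps i))

  ∩-isQuasivariety : {K N : Class L} → IsQuasivariety K → IsQuasivariety N →
                     IsQuasivariety (K ∩ N)
  ∩-isQuasivariety K N = record
    { iso-closed = λ A≅B (p , q) → K.iso-closed A≅B p , N.iso-closed A≅B q
    ; sub-closed = λ B (p , q) → K.sub-closed B p , N.sub-closed B q
    ; red-closed = λ A 𝓕 ps → K.red-closed A 𝓕 (proj₁ ∘ ps) , N.red-closed A 𝓕 (proj₂ ∘ ps)
    }
    where
    module K = IsQuasivariety K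
    module N = IsQuasivariety N

module _ {L : Signature ℓ} {Q : Quasivariety L} where

  infixr 6 _∨ᵠ_
  infixr 7 _∧ᵠ_

  _∧ᵠ_ _∨ᵠ_ : Ξ Q → Ξ Q → Ξ Q
  K ∧ᵠ N = record
    { sub  = record
      { class          = K.class ∩ N.class
      ; isQuasivariety = ∩-isQuasivariety K.isQuasivariety N.isQuasivariety
      }
    ; sub⊆ = λ p → K.sub⊆ (proj₁ p)
    }
    where
    module K = Ξ K
    module N = Ξ N
  K ∨ᵠ N = record
    { sub  = record
      { class          = Generated (K.class ∪ N.class)
      ; isQuasivariety = generated-isQuasivariety _
      }
    ; sub⊆ = generated-least (Quasivariety.isQuasivariety Q) [ K.sub⊆ , N.sub⊆ ]′
    }
    where
    module K = Ξ K
    module N = Ξ N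

Ξ-lattice : {L : Signature ℓ} → Quasivariety L → Lattice (lsuc (lsuc ℓ)) (lsuc ℓ) (lsuc ℓ)
Ξ-lattice Q = record
  { Carrier   = Ξ Q
  ; _≈_       = λ K N → Ξ.class K ≐ Ξ.class N
  ; _≤_       = λ K N → Ξ.class K ⊆ Ξ.class N
  ; _∨_       = _∨ᵠ_
  ; _∧_       = _∧ᵠ_
  ; isLattice = record
    { isPartialOrder = On.isPartialOrder Ξ.class ⊆-isPartialOrder
    ; supremum = λ K N → (λ p → gen-base (inj₁ p)) , (λ p → gen-base (inj₂ p)) ,
        λ P p q → generated-least (Ξ.isQuasivariety P) [ p , q ]′
    ; infimum  = λ K N → proj₁ , proj₂ , λ P p q x → p x , q x
    }
  }

module _ {L : Signature ℓ} where

  image : {A B : Algebra L} → Hom A B → Subalgebra B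
  image {A} {B} h = record
    { universe = λ b → ∃[ a ] to h a B.≈ b
    ; respects = λ b≈b′ (a , ha≈b) → a , B.trans ha≈b b≈b′
    ; nonempty = to h A.point , A.point , B.refl
    ; closed   = λ g xs ps → A.op g (proj₁ ∘ ps) ,
        B.trans (Hom.homo h g _) (B.op-cong g (proj₂ ∘ ps))
    }
    where
    module A = Algebra A
    module B = Algebra B

  image-iso : {A B : Algebra L} (h : Hom A B) → IsInjective h → ⌊ image h ⌋ ≅ A
  image-iso {A} {B} h inj =
      record
        { func = record
          { to   = λ (b , a , ha≈b) → a
          ; cong = λ {(b , a , p)} {(b′ , a′ , p′)} b≈b′ →
              inj (B.trans p (B.trans b≈b′ (B.sym p′)))
          }
        ; homo = λ _ _ → A.refl
        }
    , record
        { func = record { to = λ a → to h a , a , B.refl ; cong = Hom.cong h }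
        ; homo = Hom.homo h
        }
    , (λ _ → A.refl)
    , (λ (b , a , p) → p)
    where
    module A = Algebra A
    module B = Algebra B

  ≅-sym : {A B : Algebra L} → A ≅ B → B ≅ A
  ≅-sym (h , k , p , q) = k , h , q , p

  embedding-closed : {K : Class L} → IsQuasivariety K → {A B : Algebra L} (h : Hom A B) →
                     IsInjective h → B ∈ K → A ∈ K
  embedding-closed K-qv h inj B∈K = iso-closed (image-iso h inj) (sub-closed (image h) B∈K)
    where open IsQuasivariety K-qv

module _ {L : Signature ℓ} (f : Term L (Fin 1)) where

  -- 𝓑 ≼ᶠ 𝒜 for a subalgebra 𝓑 of 𝒜: the sets 𝓑ᶠ and 𝒜ᶠ are equal as
  -- subsets of 𝒜.
  IsFixedFull : {A : Algebra L} → Subalgebra A → Set ℓ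
  IsFixedFull {A} B = (λ a → ∃[ b ] b ∈ ⌊ B ⌋ ^ f × Algebra._≈_ A (proj₁ b) a) ≐ A ^ f

  module _ {A : Algebra L} (B : Subalgebra A) where

    full⇒ : IsFixedFull B → ∀ {a} → a ∈ A ^ f → a ∈ universe B
    full⇒ (_ , ⊇) fa≈a with (b , b∈B) , _ , b≈a ← ⊇ fa≈a = respects B b≈a b∈B

    full⇐ : (∀ {a} → a ∈ A ^ f → a ∈ universe B) → IsFixedFull B
    full⇐ ⊇ =
        (λ (b , fb≈b , b≈a) → ^-resp {f = f} A b≈a (^-hom {f = f} (inclusion B) fb≈b))
      , (λ {a} fa≈a → (a , ⊇ fa≈a) ,
          Algebra.trans A (eval-hom (inclusion B) f) fa≈a , Algebra.refl A)

  _↑[_] : Class L → Quasivariety L → Class L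
  (K ↑[ Y ]) A = A ∈ class Y × Σ[ B ∈ Subalgebra A ] (⌊ B ⌋ ∈ K × IsFixedFull B)

  IsPAtQuasivariety : Quasivariety L → Pred (Class L) (lsuc (lsuc ℓ))
  IsPAtQuasivariety Y C = Σ[ K ∈ Ξ Y ] C ≐ Ξ.class K ↑[ Y ]

  Ξᶠ : Quasivariety L → Set (lsuc (lsuc ℓ))
  Ξᶠ Y = ∃ (IsPAtQuasivariety Y)

module _ {L : Signature ℓ} (Y : Quasivariety L) (f : Term L (Fin 1))
         (idem : ∅ ⊨[ class Y ] (f ⟨ f ⟩ ≋ f)) where

  private
    module Y = Quasivariety Y

    _↑ : Ξ Y → Class L
    K ↑ = _↑[_] f (Ξ.class K) Y

  ⊆↑ : (K : Ξ Y) → Ξ.class K ⊆ K ↑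
  ⊆↑ K {A} A∈K = Ξ.sub⊆ K A∈K , image {A = A} {B = A} idHom
    , Ξ.iso-closed K (≅-sym {A = ⌊ image {A = A} idHom ⌋} {B = A} (image-iso idHom id)) A∈K
    , full⇐ f (image {A = A} idHom) (λ {a} _ → a , Algebra.refl A)

  ↑-mono : (K N : Ξ Y) → Ξ.class K ⊆ Ξ.class N → K ↑ ⊆ N ↑
  ↑-mono K N K⊆N (A∈Y , B , B∈K , full) = A∈Y , B , K⊆N B∈K , full

  ↑-intro : (K : Ξ Y) {A B : Algebra L} → A ∈ Y.class → (h : Hom B A) → IsInjective h →
            B ∈ Ξ.class K → (∀ {a} → a ∈ A ^ f → a ∈ universe (image h)) → A ∈ K ↑
  ↑-intro K A∈Y h inj B∈K full = A∈Y , image h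
    , Ξ.iso-closed K (≅-sym {A = ⌊ image h ⌋} (image-iso h inj)) B∈K
    , full⇐ f (image h) full

  ↑-isQuasivariety : (K : Ξ Y) → IsQuasivariety (K ↑)
  ↑-isQuasivariety K = record { iso-closed = isoC ; sub-closed = subC ; red-closed = redC }
    where
    isoC : ∀ {A A′} → A ≅ A′ → A ∈ K ↑ → A′ ∈ K ↑
    isoC {A} {A′} A≅A′@(h , k , hk≗id , kh≗id) (A∈Y , B , B∈K , full) =
      ↑-intro K (Y.iso-closed A≅A′ A∈Y) (h ⊙ inclusion B)
        (λ {x} {y} p → A.trans (A.sym (kh≗id _)) (A.trans (Hom.cong k p) (kh≗id _)))
        B∈K
        (λ {a} fa≈a → (to k a , full⇒ f B full (^-hom {f = f} k fa≈a)) , hk≗id a)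
      where module A = Algebra A

    subC : ∀ {A} (S : Subalgebra A) → A ∈ K ↑ → ⌊ S ⌋ ∈ K ↑
    subC {A} S (A∈Y , B , B∈K , full) =
      ↑-intro K S∈Y into (λ p → p) (Ξ.sub-closed K S∩B B∈K)
        (λ {a} fa≈a →
          ((proj₁ a , full⇒ f B full (^-hom {f = f} (inclusion S) fa≈a)) , proj₂ a) , Algebra.refl A)
      where
      S∈Y = Y.sub-closed S A∈Y
      fp = ^-value {f = f} idem S∈Y (nonempty S)
      S∩B : Subalgebra ⌊ B ⌋
      S∩B = record
        { universe = λ b → proj₁ b ∈ universe S
        ; respects = respects S
        ; nonempty = (_ , full⇒ f B full (^-hom {f = f} (inclusion S) fp)) , proj₂ (⌊ S ⌋ ⟦ f ⟧ λ _ → nonempty S)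
        ; closed   = λ g xs → closed S g (proj₁ ∘ xs)
        }
      into : Hom ⌊ S∩B ⌋ ⌊ S ⌋
      into = record
        { func = record { to = λ ((a , _) , s) → a , s ; cong = id }
        ; homo = λ _ _ → Algebra.refl A
        }

    redC : ∀ {I : Set ℓ} (A : I → Algebra L) (𝓕 : Filter I) → (∀ i → A i ∈ K ↑) → ⨅ A 𝓕 ∈ K ↑
    redC {I} A 𝓕 ps =
      ↑-intro K (Y.red-closed A 𝓕 (proj₁ ∘ ps)) h (λ p → p)
        (Ξ.red-closed K (λ i → ⌊ B i ⌋) 𝓕 (λ i → proj₁ (proj₂ (proj₂ (ps i)))))
        (λ {a} fa≈a →
            (λ i → A i ⟦ f ⟧ (λ _ → a i)
                 , full⇒ f (B i) (full i) (^-value {f = f} idem (proj₁ (ps i)) (a i)))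
          , F.upward (λ {i} p → Algebra.trans (A i) (Algebra.sym (A i) (eval-⨅ A 𝓕 f i)) p) fa≈a)
      where
      module F = Filter 𝓕
      B : ∀ i → Subalgebra (A i)
      B i = proj₁ (proj₂ (ps i))
      full : ∀ i → IsFixedFull f (B i)
      full i = proj₂ (proj₂ (proj₂ (ps i)))
      h : Hom (⨅ (λ i → ⌊ B i ⌋) 𝓕) (⨅ A 𝓕)
      h = record
        { func = record { to = λ b i → proj₁ (b i) ; cong = id }
        ; homo = λ _ _ → F.pure (λ i → Algebra.refl (A i))
        }

  ↑-idem : (K N : Ξ Y) → Ξ.class K ⊆ N ↑ → K ↑ ⊆ N ↑
  ↑-idem K N K⊆N↑ {A} (A∈Y , B , B∈K , full) with K⊆N↑ B∈K
  ... | _ , C , C∈N , full′ =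
    ↑-intro N A∈Y (inclusion B ⊙ inclusion C) (λ p → p) C∈N
      (λ {a} fa≈a →
          ((a , full⇒ f B full fa≈a)
          , full⇒ f C full′ (Algebra.trans A (eval-hom (inclusion B) f) fa≈a))
        , Algebra.refl A)

  ↑-∩ : (K N : Ξ Y) → K ↑ ∩ N ↑ ⊆ (K ∧ᵠ N) ↑
  ↑-∩ K N {A} ((A∈Y , B , B∈K , fullB) , (_ , C , C∈N , fullC)) =
    A∈Y , B∩C
      , ( embedding-closed (Ξ.isQuasivariety K) toB (λ p → p) B∈K
        , embedding-closed (Ξ.isQuasivariety N) toC (λ p → p) C∈N)
      , full⇐ f B∩C (λ fa≈a → full⇒ f B fullB fa≈a , full⇒ f C fullC fa≈a)
    where
    fp = ^-value {f = f} idem A∈Y (Algebra.point A)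
    B∩C : Subalgebra A
    B∩C = record
      { universe = universe B ∩ universe C
      ; respects = λ p (b , c) → respects B p b , respects C p c
      ; nonempty = _ , full⇒ f B fullB fp , full⇒ f C fullC fp
      ; closed   = λ g xs ps → closed B g xs (proj₁ ∘ ps) , closed C g xs (proj₂ ∘ ps)
      }
    toB : Hom ⌊ B∩C ⌋ ⌊ B ⌋
    toB = record
      { func = record { to = λ (a , b , _) → a , b ; cong = id }
      ; homo = λ _ _ → Algebra.refl A
      }
    toC : Hom ⌊ B∩C ⌋ ⌊ C ⌋
    toC = record
      { func = record { to = λ (a , _ , c) → a , c ; cong = id }
      ; homo = λ _ _ → Algebra.refl A
      }

  Ξᶠ-lattice : Lattice (lsuc (lsuc ℓ)) (lsuc ℓ) (lsuc ℓ)
  Ξᶠ-lattice = record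
    { Carrier   = Ξᶠ f Y
    ; _≈_       = λ C D → proj₁ C ≐ proj₁ D
    ; _≤_       = λ C D → proj₁ C ⊆ proj₁ D
    ; _∨_       = λ (_ , K , _) (_ , N , _) → (K ∨ᵠ N) ↑ , K ∨ᵠ N , id , id
    ; _∧_       = λ (C , K , C⊆K↑ , K↑⊆C) (D , N , D⊆N↑ , N↑⊆D) →
        C ∩ D , K ∧ᵠ N
          , (λ (p , q) → ↑-∩ K N (C⊆K↑ p , D⊆N↑ q))
          , (λ p → K↑⊆C (↑-mono (K ∧ᵠ N) K proj₁ p) , N↑⊆D (↑-mono (K ∧ᵠ N) N proj₂ p))
    ; isLattice = record
      { isPartialOrder = On.isPartialOrder proj₁ ⊆-isPartialOrder
      ; supremum = λ (C , K , C⊆K↑ , K↑⊆C) (D , N , D⊆N↑ , N↑⊆D) →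
          (λ p → ↑-mono K (K ∨ᵠ N) (λ x → gen-base (inj₁ x)) (C⊆K↑ p))
        , (λ p → ↑-mono N (K ∨ᵠ N) (λ x → gen-base (inj₂ x)) (D⊆N↑ p))
        , λ (E , P , E⊆P↑ , P↑⊆E) C⊆E D⊆E p → P↑⊆E (↑-idem (K ∨ᵠ N) P
            (generated-least (↑-isQuasivariety P)
              [ (λ x → E⊆P↑ (C⊆E (K↑⊆C (⊆↑ K x)))) , (λ x → E⊆P↑ (D⊆E (N↑⊆D (⊆↑ N x)))) ]′)
            p)
      ; infimum  = λ _ _ → proj₁ , proj₂ , λ _ p q x → p x , q x
      }
    }

-- X is only assumed closed under isomorphisms, subalgebras and reduced
-- products, so θ(𝒜) ∈ X has to be deduced from the preservation of
-- (infinitary) consequence.  As in Maltsev's theorem this uses excluded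
-- middle: for a ≢ b in 𝒞 = θ(𝒜), every finite part of the diagram of 𝒞
-- is realised in some member of X in which a and b are told apart, so
-- that 𝒞 embeds in a product of reduced products of members of X.
-- Constructively, the codomain of θ has to be part of the data.

module _ {L M : Signature ℓ} {X : Quasivariety L} {Y : Quasivariety M} {V : Set ℓ}
         (em : ExcludedMiddle (lsuc ℓ)) (V∞ : ℕ ↣ V) (T : SelectiveTranslation X Y V)
         (A : Algebra M) (A∈Y : A ∈ class Y) where

  private
    open SelectiveTranslation T
    module X = Quasivariety X
    module A = Algebra A

    C : Algebra L
    C = θ-alg T (A , A∈Y)
    module C = Algebra C

    em₀ : ExcludedMiddle ℓ
    em₀ = map′ lower lift em

    ι : ℕ → V
    ι = Injection.to V∞

    ζ⁎-eval : (t : Term L V) (ρ : V → ∣ C ∣) → A ⟦ ζ⁎ ζ f t ⟧ (proj₁ ∘ ρ) A.≈ proj₁ (C ⟦ t ⟧ ρ)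
    ζ⁎-eval (var x)    ρ = A.trans (eval-subst A f) (proj₂ (ρ x))
    ζ⁎-eval (app g ts) ρ =
      A.trans (eval-subst A (ζ g)) (eval-cong A (ζ g) (λ i → ζ⁎-eval (ts i) ρ))

    data Fact : Set ℓ where
      op-fact : (g : Op L) → (Fin (arity L g) → ∣ C ∣) → Fact
      ≈-fact  : (a b : ∣ C ∣) → a C.≈ b → Fact

    eqn : Fact → Equation L ∣ C ∣
    eqn (op-fact g xs) = var (C.op g xs) ≋ app g (var ∘ xs)
    eqn (≈-fact a b _) = var a ≋ var b

    support : Fact → List ∣ C ∣
    support (op-fact g xs) = C.op g xs ∷ tabulate xs
    support (≈-fact a b _) = a ∷ b ∷ []

    module Coding (xs : List ∣ C ∣) where

      enc : ∣ C ∣ → V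
      enc c with em₀ {c ∈ˡ xs}
      ... | yes c∈xs = ι (toℕ (index c∈xs))
      ... | no _     = ι 0

      dec : V → ∣ C ∣
      dec v with em₀ {∃[ k ] ι (toℕ {length xs} k) ≡ v}
      ... | yes (k , _) = lookup xs k
      ... | no _        = C.point

      dec∘enc : ∀ {c} → c ∈ˡ xs → dec (enc c) ≡ c
      dec∘enc {c} c∈xs with em₀ {c ∈ˡ xs}
      ... | no c∉xs = ⊥-elim (c∉xs c∈xs)
      ... | yes q with em₀ {∃[ k ] ι (toℕ {length xs} k) ≡ ι (toℕ (index q))}
      ...   | no none = ⊥-elim (none (index q , ≡.refl))
      ...   | yes (k , ιk≡)
        with ≡.refl ← toℕ-injective (Injection.injective V∞ ιk≡) = ≡.sym (lookup-index q)

    Separated : ∣ C ∣ → ∣ C ∣ → List Fact → Set (lsuc ℓ)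
    Separated a b Φ = Σ[ D ∈ Algebra L ] D ∈ class X × Σ[ ρ ∈ (∣ C ∣ → ∣ D ∣) ]
      (∀ {φ} → φ ∈ˡ Φ → Holds D ρ (eqn φ)) × ¬ Algebra._≈_ D (ρ a) (ρ b)

    separate : ∀ a b → ¬ (a C.≈ b) → ∀ Φ → Separated a b Φ
    separate a b a≉b Φ with em {Separated a b Φ}
    ... | yes s  = s
    ... | no  ¬s = ⊥-elim (a≉b a≈b)
      where
      open Coding (a ∷ b ∷ concatMap support Φ)

      ren : Equation L ∣ C ∣ → Equation L V
      ren (s ≋ t) = s [ var ∘ enc ] ≋ t [ var ∘ enc ]

      Φ′ : Pred (Equation L V) ℓ
      Φ′ e = ∃[ φ ] φ ∈ˡ Φ × e ≡ ren (eqn φ)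

      Φ′⊨ : Φ′ ⊨[ class X ] (var (enc a) ≋ var (enc b))
      Φ′⊨ D D∈X σ hyp with em₀ {Algebra._≈_ D (σ (enc a)) (σ (enc b))}
      ... | yes p = p
      ... | no ¬p = ⊥-elim (¬s (D , D∈X , σ ∘ enc , sat , ¬p))
        where
        sat : ∀ {φ} → φ ∈ˡ Φ → Holds D (σ ∘ enc) (eqn φ)
        sat {φ} φ∈Φ = D.trans (D.sym (eval-subst D (Equation.lhs (eqn φ))))
          (D.trans (hyp (φ , φ∈Φ , ≡.refl)) (eval-subst D (Equation.rhs (eqn φ))))
          where module D = Algebra D

      supp : ∀ {φ} c → φ ∈ˡ Φ → c ∈ˡ support φ → dec (enc c) C.≈ c
      supp c φ∈Φ c∈ = C.reflexive {x = dec (enc c)}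
        (dec∘enc (there (there (∈-concatMap⁺ support (Any.map (λ { ≡.refl → c∈ }) φ∈Φ)))))

      true : ∀ {φ} → φ ∈ˡ Φ → Holds C (dec ∘ enc) (eqn φ)
      true {op-fact g xs} φ∈Φ = A.trans (supp (C.op g xs) φ∈Φ (here ≡.refl))
        (C.op-cong g {xs} {dec ∘ enc ∘ xs}
          (λ i → A.sym (supp (xs i) φ∈Φ (there (∈-tabulate⁺ i)))))
      true {≈-fact c d p} φ∈Φ = A.trans (supp c φ∈Φ (here ≡.refl))
        (A.trans p (A.sym (supp d φ∈Φ (there (here ≡.refl)))))

      sat : ∀ {e} → e ∈ ζ* ζ f Φ′ ∪ FixedVars f → Holds A (proj₁ ∘ dec) e
      sat (inj₁ (_ , (φ , φ∈Φ , ≡.refl) , ≡.refl)) =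
        A.trans (ζ⁎-eval (Equation.lhs (ren (eqn φ))) dec)
          (A.trans (eval-subst C (Equation.lhs (eqn φ)))
            (A.trans (true φ∈Φ)
              (A.trans (A.sym (eval-subst C (Equation.rhs (eqn φ))))
                (A.sym (ζ⁎-eval (Equation.rhs (ren (eqn φ))) dec)))))
      sat (inj₂ (x , ≡.refl)) = ζ⁎-eval (var x) dec

      a≈b : a C.≈ b
      a≈b = A.trans (C.reflexive {x = a} (≡.sym (dec∘enc (here ≡.refl))))
        (A.trans (A.sym (ζ⁎-eval (var (enc a)) dec))
          (A.trans (preserves Φ′ (var (enc a) ≋ var (enc b)) Φ′⊨ A A∈Y (proj₁ ∘ dec) sat)
            (A.trans (ζ⁎-eval (var (enc b)) dec)
              (C.reflexive {y = b} (dec∘enc (there (here ≡.refl)))))))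

    eventually : Filter (List Fact)
    eventually = record
      { Large    = λ P → ∃[ Φ ] (∀ Ψ → (∀ {φ} → φ ∈ˡ Φ → φ ∈ˡ Ψ) → P Ψ)
      ; whole    = [] , _
      ; upward   = λ P⊆Q (Φ , p) → Φ , λ Ψ Φ⊆Ψ → P⊆Q (p Ψ Φ⊆Ψ)
      ; binary-∩ = λ (Φ , p) (Φ′ , q) → Φ ++ Φ′ , λ Ψ ⊆Ψ →
          p Ψ (λ x → ⊆Ψ (∈-++⁺ˡ x)) , q Ψ (λ x → ⊆Ψ (∈-++⁺ʳ Φ x))
      }

    everywhere : (I : Set ℓ) → Filter I
    everywhere I = record
      { Large    = λ P → ∀ i → P i
      ; whole    = _
      ; upward   = λ P⊆Q p i → P⊆Q (p i)
      ; binary-∩ = λ p q i → p i , q i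
      }

    Pair : Set ℓ
    Pair = Σ[ a ∈ ∣ C ∣ ] Σ[ b ∈ ∣ C ∣ ] ¬ (a C.≈ b)

    D : Pair → List Fact → Algebra L
    D (a , b , a≉b) Φ = proj₁ (separate a b a≉b Φ)

    E : Algebra L
    E = ⨅ (λ i → ⨅ (D i) eventually) (everywhere Pair)

    E∈X : E ∈ class X
    E∈X = X.red-closed (λ i → ⨅ (D i) eventually) (everywhere Pair)
      λ i@(a , b , a≉b) → X.red-closed (D i) eventually
      λ Φ → proj₁ (proj₂ (separate a b a≉b Φ))

    embed : Hom C E
    embed = record
      { func = record
        { to   = λ c (a , b , a≉b) Φ → proj₁ (proj₂ (proj₂ (separate a b a≉b Φ))) c
        ; cong = λ {c} {d} c≈d (a , b , a≉b) → ≈-fact c d c≈d ∷ [] , λ Φ ⊆Φ →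
            proj₁ (proj₂ (proj₂ (proj₂ (separate a b a≉b Φ)))) (⊆Φ (here ≡.refl))
        }
      ; homo = λ g xs (a , b , a≉b) → op-fact g xs ∷ [] , λ Φ ⊆Φ →
          proj₁ (proj₂ (proj₂ (proj₂ (separate a b a≉b Φ)))) (⊆Φ (here ≡.refl))
      }

    embed-injective : IsInjective embed
    embed-injective {a} {b} eq with em₀ {a C.≈ b}
    ... | yes a≈b = a≈b
    ... | no  a≉b with Φ , p ← eq (a , b , a≉b) =
      ⊥-elim (proj₂ (proj₂ (proj₂ (proj₂ (separate a b a≉b Φ)))) (p Φ id))

  θ∈X-classically : θ-alg T (A , A∈Y) ∈ class X
  θ∈X-classically = embedding-closed X.isQuasivariety embed embed-injective E∈X

rawLattice : ∀ {c ℓ₁ ℓ₂} → Lattice c ℓ₁ ℓ₂ → RawLattice c ℓ₁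
rawLattice L = Alg.Lattice.rawLattice (LatticeProperties.algLattice L)

module _ {L M : Signature ℓ} {X : Quasivariety L} {Y : Quasivariety M} {V : Set ℓ}
         (T : SelectiveTranslation X Y V) where

  -- As θ is only defined on members of Y, `A ∈ τ K` carries a proof of
  -- A ∈ Y; different proofs give isomorphic algebras θ(𝒜).
  τ : Ξ X → Class M
  τ K A = Σ[ A∈Y ∈ A ∈ class Y ] θ-alg T (A , A∈Y) ∈ Ξ.class K

-- τ is an order isomorphism.  Its inverse σ sends the class P↑ to the
-- class of all 𝒞 ∈ X with ℱ(𝒞) ∈ P↑: στ is the identity because η is an
-- isomorphism, and τσ is the identity because the counit ℱθ(𝒜) → 𝒜 is
-- injective with f-full image, by the triangle identity for θ.  That
-- σ(P↑) is a quasivariety rests on soberness: ℱ preserves embeddings,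
-- and ℱ(⨅ 𝒞ᵢ) embeds via ℱ(⨅ 𝒞ᵢ) → ℱθ(⨅ ℱ𝒞ᵢ) → ⨅ ℱ𝒞ᵢ.
module Submission where

open import Defs
open import Level using (Level)
open import Data.Nat using (ℕ)
open import Data.Product using (Σ-syntax; _,_; proj₁; proj₂)
open import Data.Sum using (inj₁; inj₂; [_,_]′)
open import Function.Base using (id; _∘_)
open import Function.Bundles using (_↣_)
open import Relation.Unary using (_∈_; _⊆_; _≐_)
open import Algebra.Lattice.Morphism.Structures using (IsLatticeIsomorphism)

private
  variable
    ℓ : Level

-- Quasivarieties in terms of embeddings.

module _ {L : Signature ℓ} where

  ≅-injective : {A B : Algebra L} ((h , _) : A ≅ B) → IsInjective h
  ≅-injective {A} (h , k , _ , kh≗id) p = A.trans (A.sym (kh≗id _)) (A.trans (Hom.cong k p) (kh≗id _))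
    where module A = Algebra A

  inverse-injective : {A B : Algebra L} ((_ , k , _) : A ≅ B) → IsInjective k
  inverse-injective {A} {B} A≅B = ≅-injective (≅-sym A≅B)

  -- Subalgebra inclusions and inverses of isomorphisms are both embeddings. This form suits classes
  -- pulled back along θ or ℱ, since these functors preserve embeddings.
  embedding-closed⇒isQuasivariety :
    {K : Class L} →
    ({A B : Algebra L} (h : Hom A B) → IsInjective h → B ∈ K → A ∈ K) →
    ({I : Set ℓ} (A : I → Algebra L) (𝓕 : Filter I) → (∀ i → A i ∈ K) → ⨅ A 𝓕 ∈ K) →
    IsQuasivariety K
  embedding-closed⇒isQuasivariety emb red = record
    { iso-closed = λ A≅B → emb (proj₁ (proj₂ A≅B)) (inverse-injective A≅B)
    ; sub-closed = λ B → emb (inclusion B) id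
    ; red-closed = red
    }

-- The functor θ and the classes τ(K).

module _ {L M : Signature ℓ} {X : Quasivariety L} {Y : Quasivariety M} {V : Set ℓ}
         (T : SelectiveTranslation X Y V) where
  open SelectiveTranslation T

  private
    module Y = Quasivariety Y

  -- Applying `f` in every coordinate turns a representative into a family of fixed points and, on
  -- elements fixed by `f`, leaves its class in the reduced product unchanged.
  θ-⨅-embed : {I : Set ℓ} (A : I → Algebra M) (𝓕 : Filter I) (A∈Y : ∀ i → A i ∈ class Y)
              (⨅∈Y : ⨅ A 𝓕 ∈ class Y) →
              Σ[ h ∈ Hom (θ-alg T (⨅ A 𝓕 , ⨅∈Y)) (⨅ (λ i → θ-alg T (A i , A∈Y i)) 𝓕) ] IsInjective h
  θ-⨅-embed {I} A 𝓕 A∈Y ⨅∈Y = record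
      { func = record
        { to   = λ (a , _) → retract a
        ; cong = λ {(a , fa≈a)} {(b , fb≈b)} a≈b →
            P.trans (retract-fixes fa≈a) (P.trans a≈b (P.sym (retract-fixes fb≈b)))
        }
      ; homo = λ g xs → P.trans
          (retract-fixes (proj₂ (Θ.op g xs)))
          (P.trans
            (eval-cong P (ζ g) (λ k → P.sym (retract-fixes (proj₂ (xs k)))))
            (F.pure (eval-⨅ A 𝓕 (ζ g))))
      }
    , λ {(a , fa≈a)} {(b , fb≈b)} p →
        P.trans (P.sym (retract-fixes fa≈a)) (P.trans p (retract-fixes fb≈b))
    where
    module F = Filter 𝓕
    P = ⨅ A 𝓕
    module P = Algebra P
    module Θ = Algebra (θ-alg T (P , ⨅∈Y))

    -- The elements of θ(⨅ 𝒜ᵢ) are fixed by f only 𝓕-almost everywhere.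
    retract : ∣ P ∣ → ∀ i → ∣ θ-alg T (A i , A∈Y i) ∣
    retract a i = A i ⟦ f ⟧ (λ _ → a i) , ^-value {f = f} idempotent (A∈Y i) (a i)

    retract-fixes : ∀ {a} → a ∈ P ^ f → (λ i → proj₁ (retract a i)) P.≈ a
    retract-fixes = P.trans (P.sym (F.pure (eval-⨅ A 𝓕 f)))

  module _ (K : Ξ X) where

    θ-embedding-closed : {A B : Obj (class Y)} (h : Hom (proj₁ A) (proj₁ B)) → IsInjective h →
                         θ-alg T B ∈ Ξ.class K → θ-alg T A ∈ Ξ.class K
    θ-embedding-closed {A} {B} h inj =
      embedding-closed (Ξ.isQuasivariety K) (θ-hom T A B h) inj

    -- Replaces the proof of membership in `Y` that `τ` carries by a given one: the identity map
    -- embeds one version of θ(𝒜) in the other.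
    τ-θ : (A : Obj (class Y)) → proj₁ A ∈ τ T K → θ-alg T A ∈ Ξ.class K
    τ-θ A (A∈Y , θA∈K) = θ-embedding-closed {A} {proj₁ A , A∈Y} idHom id θA∈K

    τ-isQuasivariety : IsQuasivariety (τ T K)
    τ-isQuasivariety = embedding-closed⇒isQuasivariety
      (λ h inj (B∈Y , θB∈K) →
        let A∈Y = embedding-closed Y.isQuasivariety h inj B∈Y in
        A∈Y , θ-embedding-closed {_ , A∈Y} {_ , B∈Y} h inj θB∈K)
      (λ A 𝓕 ps →
        let ⨅∈Y     = Y.red-closed A 𝓕 (proj₁ ∘ ps)
            h , inj = θ-⨅-embed A 𝓕 (proj₁ ∘ ps) ⨅∈Y
        in ⨅∈Y , embedding-closed (Ξ.isQuasivariety K) h (λ {a} {b} → inj {a} {b})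
             (Ξ.red-closed K _ 𝓕 (proj₂ ∘ ps)))

    τᵠ : Ξ Y
    τᵠ = record
      { sub  = record { class = τ T K ; isQuasivariety = τ-isQuasivariety }
      ; sub⊆ = proj₁
      }

    -- An f-full subalgebra 𝓑 contains all fixed points of 𝒜, so θ(𝒜) embeds in θ(𝓑). Hence τ(K) is
    -- its own upward closure.
    τ-↑-closed : _↑[_] f (τ T K) Y ⊆ τ T K
    τ-↑-closed {A} (A∈Y , B , (B∈Y , θB∈K) , full) =
      A∈Y , embedding-closed (Ξ.isQuasivariety K) corestrict id θB∈K
      where
      corestrict : Hom (θ-alg T (A , A∈Y)) (θ-alg T (⌊ B ⌋ , B∈Y))
      corestrict = record
        { func = record
          { to   = λ (a , fa≈a) → (a , full⇒ f B full fa≈a) ,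
              Algebra.trans A (eval-hom (inclusion B) f) fa≈a
          ; cong = id
          }
        ; homo = λ g xs → Algebra.sym A (eval-hom (inclusion B) (ζ g))
        }

    τ-isPAtQuasivariety : τ T K ∈ IsPAtQuasivariety f Y
    τ-isPAtQuasivariety = τᵠ , ⊆↑ Y f idempotent τᵠ , τ-↑-closed

  τ-mono : (K N : Ξ X) → Ξ.class K ⊆ Ξ.class N → τ T K ⊆ τ T N
  τ-mono K N K⊆N (A∈Y , θA∈K) = A∈Y , K⊆N θA∈K

  -- The left adjoint ℱ and soberness.

  module _ (θ∈X : ∀ A → θ-alg T A ∈ class X) (F : Functor (class X) (class Y))
           (F⊣θ : F ⊣ θ T θ∈X) (sober : IsSober F⊣θ) where
    open Functor F
    open _⊣_ F⊣θ
    open IsSober sober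

    η-iso : (C : Obj (class X)) → proj₁ C ≅ θ-alg T (F₀ C)
    η-iso C = η C , isStronglySelective C

    F₀∈τ : (K : Ξ X) (C : Obj (class X)) → proj₁ C ∈ Ξ.class K → proj₁ (F₀ C) ∈ τ T K
    F₀∈τ K C C∈K = proj₂ (F₀ C) , Ξ.iso-closed K (η-iso C) C∈K

    F₀∈τ⁻¹ : (K : Ξ X) (C : Obj (class X)) → proj₁ (F₀ C) ∈ τ T K → proj₁ C ∈ Ξ.class K
    F₀∈τ⁻¹ K C FC∈τK = Ξ.iso-closed K (≅-sym (η-iso C)) (τ-θ K (F₀ C) FC∈τK)

    -- The inclusion is tested on the algebras ℱ(𝒞): through η, 𝒞 lies in K exactly when ℱ(𝒞) lies
    -- in τ(K).
    τ-cancel-⊆ : (K N : Ξ X) → τ T K ⊆ τ T N → Ξ.class K ⊆ Ξ.class N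
    τ-cancel-⊆ K N τK⊆τN {C} C∈K =
      let C′ = C , Ξ.sub⊆ K C∈K in F₀∈τ⁻¹ N C′ (τK⊆τN (F₀∈τ K C′ C∈K))

    module _ (P : Ξ Y) where

      private
        P↑ : Class M
        P↑ = _↑[_] f (Ξ.class P) Y

        P↑-qv : IsQuasivariety P↑
        P↑-qv = ↑-isQuasivariety Y f idempotent P

      σ : Class L
      σ C = Σ[ C∈X ∈ C ∈ class X ] proj₁ (F₀ (C , C∈X)) ∈ P↑

      F₀-embedding-closed : {C D : Obj (class X)} (h : Hom (proj₁ C) (proj₁ D)) → IsInjective h →
                            proj₁ (F₀ D) ∈ P↑ → proj₁ (F₀ C) ∈ P↑
      F₀-embedding-closed {C} {D} h inj =
        embedding-closed P↑-qv (F₁ {C} {D} h) (F-injective C D h inj)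

      Fθ∈↑ : (A : Obj (class Y)) → proj₁ A ∈ P↑ → proj₁ (F₀ (θ-alg T A , θ∈X A)) ∈ P↑
      Fθ∈↑ A = embedding-closed P↑-qv (ε A) (ε-injective A)

      Fθ∈↑⁻¹ : (A : Obj (class Y)) → proj₁ (F₀ (θ-alg T A , θ∈X A)) ∈ P↑ → proj₁ A ∈ P↑
      Fθ∈↑⁻¹ A (_ , B , B∈P , full) =
        ↑-intro Y f idempotent P (proj₂ A) (ε A ⊙ inclusion B) (ε-injective A) B∈P
          (λ {a} fa≈a →
            -- The preimage of a under ε is η(a). It is fixed by `f`, hence lies in 𝓑 by fullness.
            let b , fb≈b = to (η (θ-alg T A , θ∈X A)) (a , fa≈a)
            in (b , full⇒ f B full fb≈b) , zag A (a , fa≈a))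

      σ-red-closed : {I : Set ℓ} (C : I → Algebra L) (𝓕 : Filter I) →
                     (∀ i → C i ∈ σ) → ⨅ C 𝓕 ∈ σ
      σ-red-closed C 𝓕 ps =
        ⨅C∈X , F₀-embedding-closed {_ , ⨅C∈X} {_ , θ∈X R} units units-injective
          (Fθ∈↑ R (IsQuasivariety.red-closed P↑-qv FC 𝓕 (proj₂ ∘ ps)))
        where
        module 𝓕 = Filter 𝓕
        ⨅C∈X = Quasivariety.red-closed X C 𝓕 (proj₁ ∘ ps)

        C′ : ∀ i → Obj (class X)
        C′ i = C i , proj₁ (ps i)

        FC : ∀ i → Algebra M
        FC i = proj₁ (F₀ (C′ i))

        R : Obj (class Y)
        R = ⨅ FC 𝓕 , Y.red-closed FC 𝓕 (λ i → proj₂ (F₀ (C′ i)))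

        -- The units η taken coordinatewise; `eval-⨅` relates the terms `f` and `ζ g` evaluated in
        -- the reduced product to their values in each factor.
        units : Hom (⨅ C 𝓕) (θ-alg T R)
        units = record
          { func = record
            { to   = λ c → (λ i → proj₁ (to (η (C′ i)) (c i)))
                , 𝓕.pure (λ i → Algebra.trans (FC i) (eval-⨅ FC 𝓕 f i) (proj₂ (to (η (C′ i)) (c i))))
            ; cong = 𝓕.upward (λ {i} → Hom.cong (η (C′ i)))
            }
          ; homo = λ g xs → 𝓕.pure (λ i → Algebra.trans (FC i)
              (Hom.homo (η (C′ i)) g (λ k → xs k i))
              (Algebra.sym (FC i) (eval-⨅ FC 𝓕 (ζ g) i)))
          }

        units-injective : IsInjective units
        units-injective = 𝓕.upward (λ {i} → ≅-injective (η-iso (C′ i)))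

      σᵠ : Ξ X
      σᵠ = record
        { sub  = record
          { class          = σ
          ; isQuasivariety = embedding-closed⇒isQuasivariety
              (λ h inj (D∈X , FD∈P↑) →
                let C∈X = embedding-closed (Quasivariety.isQuasivariety X) h inj D∈X in
                C∈X , F₀-embedding-closed {_ , C∈X} {_ , D∈X} h inj FD∈P↑)
              σ-red-closed
          }
        ; sub⊆ = proj₁
        }

      τσ⊆↑ : τ T σᵠ ⊆ P↑
      τσ⊆↑ {A} (A∈Y , θA∈X , FθA∈P↑) = Fθ∈↑⁻¹ (A , A∈Y)
        -- `F₀` may depend on the proof of θ(𝒜) ∈ X, so the identity map is used to pass from one
        -- proof to the other.
        (F₀-embedding-closed {_ , θ∈X (A , A∈Y)} {_ , θA∈X} idHom id FθA∈P↑)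

      ↑⊆τσ : P↑ ⊆ τ T σᵠ
      ↑⊆τσ {A} A∈P↑@(A∈Y , _) = A∈Y , θ∈X (A , A∈Y) , Fθ∈↑ (A , A∈Y) A∈P↑

      -- Half of the Galois connection between τ and σ, as ℱ sends K into τ(K).
      ⊆σ : (K : Ξ X) → τ T K ⊆ P↑ → Ξ.class K ⊆ σ
      ⊆σ K τK⊆P↑ C∈K = Ξ.sub⊆ K C∈K , τK⊆P↑ (F₀∈τ K (_ , Ξ.sub⊆ K C∈K) C∈K)

    -- From left to right, K ∨ N lies below σ(P) because K and N do, and τσ(P) is contained in P↑.
    -- Conversely, τ(K ∨ N) is a quasivariety containing τ(K) and τ(N), and it is closed under ↑.
    τ-∨ : (K N : Ξ X) → τ T (K ∨ᵠ N) ≐ _↑[_] f (Ξ.class (τᵠ K ∨ᵠ τᵠ N)) Y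
    τ-∨ K N =
        (λ p → τσ⊆↑ P (τ-mono (K ∨ᵠ N) (σᵠ P) K∨N⊆σ p))
      , (λ p → τ-↑-closed (K ∨ᵠ N) (↑-mono Y f idempotent P (τᵠ (K ∨ᵠ N)) P⊆τ p))
      where
      P = τᵠ K ∨ᵠ τᵠ N

      K∨N⊆σ : Ξ.class (K ∨ᵠ N) ⊆ σ P
      K∨N⊆σ = generated-least (Ξ.isQuasivariety (σᵠ P))
        [ ⊆σ P K (λ p → ⊆↑ Y f idempotent P (gen-base (inj₁ p)))
        , ⊆σ P N (λ p → ⊆↑ Y f idempotent P (gen-base (inj₂ p))) ]′

      P⊆τ : Ξ.class P ⊆ τ T (K ∨ᵠ N)
      P⊆τ = generated-least (τ-isQuasivariety (K ∨ᵠ N))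
        [ τ-mono K (K ∨ᵠ N) (λ p → gen-base (inj₁ p))
        , τ-mono N (K ∨ᵠ N) (λ p → gen-base (inj₂ p)) ]′

proposition6p14 : ∀ {ℓ : Level} {L M : Signature ℓ} (X : Quasivariety L) (Y : Quasivariety M)
    (V : Set ℓ) → ℕ ↣ V →
    (T : SelectiveTranslation X Y V) →
    let open SelectiveTranslation T in
    (θ∈X : ∀ A → θ-alg T A ∈ class X) →
    (F : Functor (class X) (class Y)) (F⊣θ : F ⊣ θ T θ∈X) →
    IsSober F⊣θ →
    Σ[ τ∈Ξᶠ ∈ (∀ K → τ T K ∈ IsPAtQuasivariety f Y) ]
    IsLatticeIsomorphism (rawLattice (Ξ-lattice X)) (rawLattice (Ξᶠ-lattice Y f idempotent))
    (λ K → τ T K , τ∈Ξᶠ K)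
proposition6p14 X Y V _ T θ∈X F F⊣θ sober = τ-isPAtQuasivariety T , record
  { isLatticeMonomorphism = record
    { isLatticeHomomorphism = record
      { isRelHomomorphism = record
        { cong = λ {K} {N} (K⊆N , N⊆K) → τ-mono T K N K⊆N , τ-mono T N K N⊆K }
      ; ∧-homo = λ K N →
            (λ (A∈Y , θA∈K , θA∈N) → (A∈Y , θA∈K) , (A∈Y , θA∈N))
          -- The two memberships carry separate proofs of 𝒜 ∈ Y; the second is aligned with the
          -- first.
          , (λ ((A∈Y , θA∈K) , A∈τN) → A∈Y , θA∈K , τ-θ T N (_ , A∈Y) A∈τN)
      ; ∨-homo = τ-∨ T θ∈X F F⊣θ sober
      }
    ; injective = λ {K} {N} (τK⊆τN , τN⊆τK) →
        τ-cancel-⊆ T θ∈X F F⊣θ sober K N τK⊆τN , τ-cancel-⊆ T θ∈X F F⊣θ sober N K τN⊆τK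
    }
  ; surjective = λ (C , P , C⊆P↑ , P↑⊆C) →
      let σP = σᵠ T θ∈X F F⊣θ sober P in
      -- Surjectivity is up to lattice equality: every `K` with the same members as σ(P) has to be
      -- sent to `C`.
      σP , λ {K} (K⊆σP , σP⊆K) →
          (λ p → P↑⊆C (τσ⊆↑ T θ∈X F F⊣θ sober P (τ-mono T K σP K⊆σP p)))
        , (λ p → τ-mono T σP K σP⊆K (↑⊆τσ T θ∈X F F⊣θ sober P (C⊆P↑ p)))
  }
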